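{- There is an absolute constant $C>0$ such that for all integers $n\ge 3$ and $m$ with $n-1\le m\le (n-1)^2/4$, $$\tilde{r}(\mathcal{C}_{\mathrm{odd}},\mathcal{C}on_{n,m})\ \le\ n+2m+C\sqrt{m-n+1}.$$
   Context: For nonempty families $\mathcal H_1,\mathcal H_2$ of finite graphs, the online size Ramsey game is played on the edge set of the complete graph $K_{\mathbb N}$ on vertex set $\mathbb N$: in each round Builder selects a previously unselected edge and Painter colours it red or blue. The game ends as soon as, after Painter's move, there is a red copy of some graph from $\mathcal H_1$ or a blue copy of some graph from $\mathcal H_2$. Builder aims to end the game as quickly as possible, Painter to delay it. The online size Ramsey number $\tilde{r}(\mathcal H_1,\mathcal H_2)$ is the number of rounds the game lasts when both players play optimally. $\mathcal{C}_{\mathrm{odd}}$ denotes the family of all odd cycles, and $\mathcal{C}on_{n,m}$ denotes the family of all connected graphs with exactly $n$ vertices and at least $m$ edges. -}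

module Defs where

open import Data.Nat using (ℕ; zero; suc; _+_; _*_; _<_; _≥_)
open import Data.Fin using (Fin; toℕ; inject₁; fromℕ) renaming (zero to fzero; suc to fsuc)
import Data.Product
open import Data.Product using (Σ; ∃; ∃-syntax; _×_; _,_)
open import Data.Sum using (_⊎_)
open import Data.List using (List; length; _∷_; [])
open import Data.List.Membership.Propositional using (_∈_)
open import Data.List.Relation.Unary.All using (All)
open import Data.List.Relation.Unary.Unique.Propositional using (Unique)
open import Function.Definitions using (Injective)
open import Relation.Binary.PropositionalEquality using (_≡_; _≢_)
open import Relation.Nullary using (¬_)

data Colour : Set where
  red blue : Colour

-- A position of the game: the list of edges selected so far (edges of K_ℕ,
-- given as a pair of vertices, read as unordered) together with their colours.
Position : Set
Position = List (ℕ × ℕ × Colour)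

Coloured : Position → Colour → ℕ → ℕ → Set
Coloured P c u v = ((u , v , c) ∈ P) ⊎ ((v , u , c) ∈ P)

Selected : Position → ℕ → ℕ → Set
Selected P u v = ∃[ c ] Coloured P c u v

-- A red copy of the odd cycle C_{2k+3}: an injective labelling
-- f : Fin (2k+3) → ℕ with f i f (i+1) red for all i (indices mod 2k+3).
RedCycle : Position → ℕ → Set
RedCycle P k =
  Σ (Fin (suc (suc (suc (k + k)))) → ℕ) λ f →
    Injective _≡_ _≡_ f
    × ((i : Fin (suc (suc (k + k)))) → Coloured P red (f (inject₁ i)) (f (fsuc i)))
    × Coloured P red (f (fromℕ (suc (suc (k + k))))) (f fzero)

RedOddCycle : Position → Set
RedOddCycle P = ∃[ k ] RedCycle P k

record SimpleGraph (n : ℕ) : Set where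
  field
    edges   : List (Fin n × Fin n)
    ordered : All (λ e → toℕ (Data.Product.proj₁ e) < toℕ (Data.Product.proj₂ e)) edges
    unique  : Unique edges

open SimpleGraph public

Adj : {n : ℕ} → SimpleGraph n → Fin n → Fin n → Set
Adj H i j = ((i , j) ∈ edges H) ⊎ ((j , i) ∈ edges H)

numEdges : {n : ℕ} → SimpleGraph n → ℕ
numEdges H = length (edges H)

data Reach {n : ℕ} (H : SimpleGraph n) : Fin n → Fin n → Set where
  here : ∀ {i} → Reach H i i
  step : ∀ {i j l} → Adj H i j → Reach H j l → Reach H i l

Connected : {n : ℕ} → SimpleGraph n → Set
Connected H = ∀ i j → Reach H i j

InCon : (n m : ℕ) → SimpleGraph n → Set
InCon n m H = Connected H × numEdges H ≥ m

BlueCopy : Position → {n : ℕ} → SimpleGraph n → Set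
BlueCopy P {n} H =
  Σ (Fin n → ℕ) λ f →
    Injective _≡_ _≡_ f
    × (∀ {i j} → (i , j) ∈ edges H → Coloured P blue (f i) (f j))

BlueCon : ℕ → ℕ → Position → Set
BlueCon n m P = Σ (SimpleGraph n) λ H → InCon n m H × BlueCopy P H

Ended : ℕ → ℕ → Position → Set
Ended n m P = RedOddCycle P ⊎ BlueCon n m P

BuilderWinsWithin : ℕ → ℕ → ℕ → Position → Set
BuilderWinsWithin n m zero    P = Ended n m P
BuilderWinsWithin n m (suc k) P =
  Ended n m P
  ⊎ (Σ ℕ λ u → Σ ℕ λ v → u ≢ v × ¬ Selected P u v
       × ((c : Colour) → BuilderWinsWithin n m k ((u , v , c) ∷ P)))

OnlineRamseyLe : ℕ → ℕ → ℕ → Set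
OnlineRamseyLe n m k = BuilderWinsWithin n m k []

{-# OPTIONS --safe #-}
-- Builder wins within n + 2m rounds, and the only red cycles needed are triangles.
-- Put N = n − 1 and m = N + e.
--
-- Builder first joins one vertex to new vertices until it has N blue or n red
-- neighbours, which takes at most N + n rounds.  If there are n red neighbours, all
-- edges between them are forced to be blue: N rounds make a blue star on them and
-- e more rounds finish.  Otherwise there is a blue star with N leaves, and Builder
-- adds e blue edges between the leaves in at most N + 2e rounds, as follows.
--
-- The leaves are processed one at a time, the processed ones being split into
-- disjoint red edges ("pairs") and singles.  A new leaf z is first joined to an end
-- x of each pair xy and, if zx is red, also to y, which is forced to be blue.
-- Then z is joined to the singles until some zu is red, which makes zu a pair; if
-- there is no such u, then z becomes a single.  So at most one red edge per leaf is not
-- followed by a forced blue one.  With u singles and k pairs the number of blue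
-- edges obtained is at least u(u−1)/2 + ku + k(k−1), and u + 2k = N at the end gives
-- at least N²/4 − N/2 ≥ e of them.
module Submission where

open import Defs
open import Data.Nat using (ℕ; _+_; _*_; _∸_; _^_; _≤_)
open import Data.Product using (∃-syntax; _×_)

open import Data.Nat using (zero; suc; _<_; z≤n; s≤s)
open import Data.Nat.Properties hiding (suc-injective)
open import Data.Nat.Tactic.RingSolver using (solve-∀)
open import Data.Fin using (Fin; toℕ; fromℕ<) renaming (zero to fzero; suc to fsuc)
open import Data.Fin.Properties using (toℕ<n; toℕ-fromℕ<; toℕ-injective; suc-injective)
open import Data.List using (List; []; _∷_; _++_; length; map; allFin)
open import Data.List.Properties using (length-++; length-map; length-tabulate)
open import Data.List.Membership.Propositional using (_∈_)
open import Data.List.Membership.Propositional.Properties using (∈-map⁺; ∈-map⁻; ∈-allFin)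
open import Data.List.Relation.Unary.Any using (here; there)
open import Data.List.Relation.Unary.All as All using (All; []; _∷_)
open import Data.List.Relation.Unary.AllPairs using ([]; _∷_)
open import Data.List.Relation.Unary.Unique.Propositional using (Unique)
open import Data.List.Relation.Unary.Unique.Propositional.Properties using (allFin⁺; map⁺)
open import Data.List.Relation.Binary.Permutation.Propositional using (_↭_; ↭-refl; ↭-sym; ↭-trans; ↭-prep; ↭⇒↭ₛ)
open import Data.List.Relation.Binary.Permutation.Propositional.Properties using (All-resp-↭; ↭-length; shift; ++⁺ˡ)
import Data.List.Relation.Binary.Permutation.Setoid.Properties as Permutationₛ
open import Data.Product using (Σ; _,_; proj₁; proj₂)
open import Data.Sum using (_⊎_; inj₁; inj₂; swap) renaming (map to map-⊎)
open import Function using (_∘_; id)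
open import Function.Definitions using (Injective)
open import Relation.Binary.PropositionalEquality using (_≡_; _≢_; refl; sym; trans; cong; subst; setoid)
open import Relation.Nullary using (¬_; contradiction)

-- Coloured edges in a growing position, and red triangles.

coloured-∷ : ∀ {P e c a b} → Coloured P c a b → Coloured (e ∷ P) c a b
coloured-∷ = map-⊎ there there

coloured-new : ∀ {P a b c} → Coloured ((a , b , c) ∷ P) c a b
coloured-new = inj₁ (here refl)

selected-∷⁻ : ∀ {P p q c a b} → Selected ((p , q , c) ∷ P) a b
            → (a ≡ p × b ≡ q) ⊎ (a ≡ q × b ≡ p) ⊎ Selected P a b
selected-∷⁻ (_ , inj₁ (here refl)) = inj₁ (refl , refl)
selected-∷⁻ (_ , inj₂ (here refl)) = inj₂ (inj₁ (refl , refl))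
selected-∷⁻ (c , inj₁ (there s))   = inj₂ (inj₂ (c , inj₁ s))
selected-∷⁻ (c , inj₂ (there s))   = inj₂ (inj₂ (c , inj₂ s))

triangle : ∀ {P a b c} → a ≢ b → b ≢ c → a ≢ c
         → Coloured P red a b → Coloured P red b c → Coloured P red a c → RedOddCycle P
triangle {P} {a} {b} {c} a≢b b≢c a≢c ab bc ac = 0 , v , v-injective , path , swap ac
  where
  v : Fin 3 → ℕ
  v fzero               = a
  v (fsuc fzero)        = b
  v (fsuc (fsuc fzero)) = c

  v-injective : Injective _≡_ _≡_ v
  v-injective {fzero}               {fzero}               _  = refl
  v-injective {fzero}               {fsuc fzero}          eq = contradiction eq a≢b
  v-injective {fzero}               {fsuc (fsuc fzero)}   eq = contradiction eq a≢c
  v-injective {fsuc fzero}          {fzero}               eq = contradiction (sym eq) a≢b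
  v-injective {fsuc fzero}          {fsuc fzero}          _  = refl
  v-injective {fsuc fzero}          {fsuc (fsuc fzero)}   eq = contradiction eq b≢c
  v-injective {fsuc (fsuc fzero)}   {fzero}               eq = contradiction (sym eq) a≢c
  v-injective {fsuc (fsuc fzero)}   {fsuc fzero}          eq = contradiction (sym eq) b≢c
  v-injective {fsuc (fsuc fzero)}   {fsuc (fsuc fzero)}   _  = refl

  path : (i : Fin 2) → _
  path fzero        = ab
  path (fsuc fzero) = bc

-- Spare rounds and the round budget.

wins-ended : ∀ {n m P} k → Ended n m P → BuilderWinsWithin n m k P
wins-ended zero    E = E
wins-ended (suc k) E = inj₁ E

wins-suc : ∀ {n m P} k → BuilderWinsWithin n m k P → BuilderWinsWithin n m (suc k) P
wins-suc zero    W                                 = inj₁ W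
wins-suc (suc k) (inj₁ E)                          = inj₁ E
wins-suc (suc k) (inj₂ (u , v , u≢v , ¬sel , W)) = inj₂ (u , v , u≢v , ¬sel , λ c → wins-suc k (W c))

wins-+ : ∀ {n m P} j {k} → BuilderWinsWithin n m k P → BuilderWinsWithin n m (j + k) P
wins-+ zero    W = W
wins-+ (suc j) W = wins-suc (j + _) (wins-+ j W)

-- w + 2d, in a form that computes on d.
rounds : ℕ → ℕ → ℕ
rounds zero    w = w
rounds (suc d) w = suc (suc (rounds d w))

rounds-suc : ∀ d w → rounds d (suc w) ≡ suc (rounds d w)
rounds-suc zero    w = refl
rounds-suc (suc d) w = cong (suc ∘ suc) (rounds-suc d w)

rounds-+ : ∀ d w → rounds d w ≡ w + 2 * d
rounds-+ zero    w = sym (+-identityʳ w)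
rounds-+ (suc d) w = trans (cong (suc ∘ suc) (rounds-+ d w)) (lemma w d)
  where
  lemma : ∀ w d → suc (suc (w + 2 * d)) ≡ w + 2 * suc d
  lemma = solve-∀

-- Counting blue edges by singles and pairs.

module _ {A : Set} where

  flatten : List (A × A) → List A
  flatten []            = []
  flatten ((x , y) ∷ M) = x ∷ y ∷ flatten M

  length-flatten : ∀ M → length (flatten M) ≡ 2 * length M
  length-flatten []      = refl
  length-flatten (_ ∷ M) = trans (cong (suc ∘ suc) (length-flatten M)) (lemma (length M))
    where
    lemma : ∀ k → suc (suc (2 * k)) ≡ 2 * suc k
    lemma = solve-∀

-- A new single gains a blue edge to one end of each of the `k` pairs and to each of the `u`
-- singles. The invariant is twice `c ≥ N + u(u-1)/2 + ku + k(k-1)`; the processed leaves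
-- `j = u + 2k` are moved to the right so that nothing is subtracted.
singles-bound : ∀ N u k {c c′ j} → 2 * N + (u * u + 2 * (k * u) + 2 * (k * k)) ≤ 2 * c + j
              → c + k + u ≤ c′
              → 2 * N + (suc u * suc u + 2 * (k * suc u) + 2 * (k * k)) ≤ 2 * c′ + suc j
singles-bound N u k {c} {c′} {j} h c≤c′ = begin
  2 * N + (suc u * suc u + 2 * (k * suc u) + 2 * (k * k))             ≡⟨ lhs N u k ⟩
  2 * N + (u * u + 2 * (k * u) + 2 * (k * k)) + (2 * k + 2 * u + 1)   ≤⟨ +-monoˡ-≤ _ h ⟩
  2 * c + j + (2 * k + 2 * u + 1)                                     ≡⟨ rhs c j u k ⟩
  2 * (c + k + u) + suc j                                             ≤⟨ +-monoˡ-≤ (suc j) (*-monoʳ-≤ 2 c≤c′) ⟩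
  2 * c′ + suc j                                                      ∎
  where
  open ≤-Reasoning
  lhs : ∀ N u k → 2 * N + (suc u * suc u + 2 * (k * suc u) + 2 * (k * k))
                  ≡ 2 * N + (u * u + 2 * (k * u) + 2 * (k * k)) + (2 * k + 2 * u + 1)
  lhs = solve-∀
  rhs : ∀ c j u k → 2 * c + j + (2 * k + 2 * u + 1) ≡ 2 * (c + k + u) + suc j
  rhs = solve-∀

-- A leaf that takes a single as its partner is credited only with its `k` blue edges to the old
-- pairs.
pairs-bound : ∀ N u k {c c′ j} → 2 * N + (suc u * suc u + 2 * (k * suc u) + 2 * (k * k)) ≤ 2 * c + j
            → c + k ≤ c′
            → 2 * N + (u * u + 2 * (suc k * u) + 2 * (suc k * suc k)) ≤ 2 * c′ + suc j
pairs-bound N u k {c} {c′} {j} h c≤c′ = begin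
  2 * N + (u * u + 2 * (suc k * u) + 2 * (suc k * suc k))                      ≡⟨ lhs N u k ⟩
  2 * N + (suc u * suc u + 2 * (k * suc u) + 2 * (k * k)) + (2 * k + 1)        ≤⟨ +-monoˡ-≤ _ h ⟩
  2 * c + j + (2 * k + 1)                                                      ≡⟨ rhs c j k ⟩
  2 * (c + k) + suc j                                                          ≤⟨ +-monoˡ-≤ (suc j) (*-monoʳ-≤ 2 c≤c′) ⟩
  2 * c′ + suc j                                                               ∎
  where
  open ≤-Reasoning
  lhs : ∀ N u k → 2 * N + (u * u + 2 * (suc k * u) + 2 * (suc k * suc k))
                  ≡ 2 * N + (suc u * suc u + 2 * (k * suc u) + 2 * (k * k)) + (2 * k + 1)
  lhs = solve-∀
  rhs : ∀ c j k → 2 * c + j + (2 * k + 1) ≡ 2 * (c + k) + suc j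
  rhs = solve-∀

-- Twice the quadratic form is `N ^ 2 + u * u`, so the invariant with `j = N` gives
-- `4c ≥ N ^ 2 + u * u + 2N`, which is at least `4m`.
final-bound : ∀ u k {m c} → let N = 2 * k + u in 4 * m ≤ N ^ 2
            → 2 * N + (u * u + 2 * (k * u) + 2 * (k * k)) ≤ 2 * c + N
            → m ≤ c
final-bound u k {m} {c} m≤ h = *-cancelˡ-≤ 4 (+-cancelʳ-≤ (2 * N) _ _ (begin
  4 * m + 2 * N                                           ≤⟨ +-monoˡ-≤ (2 * N) m≤ ⟩
  N ^ 2 + 2 * N                                           ≤⟨ m≤m+n _ (u * u + 2 * N) ⟩
  N ^ 2 + 2 * N + (u * u + 2 * N)                         ≡⟨ lhs u k ⟩
  2 * (2 * N + (u * u + 2 * (k * u) + 2 * (k * k)))       ≤⟨ *-monoʳ-≤ 2 h ⟩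
  2 * (2 * c + N)                                         ≡⟨ rhs c N ⟩
  4 * c + 2 * N                                           ∎))
  where
  open ≤-Reasoning
  N = 2 * k + u
  lhs : ∀ u k → (2 * k + u) * ((2 * k + u) * 1) + 2 * (2 * k + u) + (u * u + 2 * (2 * k + u))
                ≡ 2 * (2 * (2 * k + u) + (u * u + 2 * (k * u) + 2 * (k * k)))
  lhs = solve-∀
  rhs : ∀ c N → 2 * (2 * c + N) ≡ 4 * c + 2 * N
  rhs = solve-∀

-- Blue graphs containing a spanning star.

module BlueStar {N m : ℕ} (f : Fin (suc N) → ℕ) (f-injective : Injective _≡_ _≡_ f) where

  Wins : ℕ → Position → Set
  Wins = BuilderWinsWithin (suc N) m

  leaf : Fin N → ℕ
  leaf i = f (fsuc i)

  leaf-injective : Injective _≡_ _≡_ leaf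
  leaf-injective = suc-injective ∘ f-injective

  -- A hub lies outside the image of `f` and turns every red edge inside the image into a red
  -- triangle, so Painter is forced to play blue there.
  RedHub : Position → Set
  RedHub P = Σ ℕ λ h → (∀ i → h ≢ f i) × (∀ i → Coloured P red h (f i))

  hub-ended : ∀ {P i j} → RedHub P → i ≢ j → Coloured P red (f i) (f j) → Ended (suc N) m P
  hub-ended {i = i} {j} (h , h≢ , hub) i≢j r =
    inj₁ (triangle (h≢ i) (i≢j ∘ f-injective) (h≢ j) (hub i) r (hub j))

  hub-∷ : ∀ {P e} → RedHub P → RedHub (e ∷ P)
  hub-∷ (h , h≢ , hub) = h , h≢ , coloured-∷ ∘ hub

  -- Keeping all spokes from the centre makes the graph connected at every stage, so only the number
  -- of edges remains to be raised.
  record BlueGraph (P : Position) (c : ℕ) : Set where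
    field
      graph  : SimpleGraph (suc N)
      spokes : ∀ i → (fzero , fsuc i) ∈ edges graph
      size   : c ≤ numEdges graph
      blues  : ∀ {i j} → (i , j) ∈ edges graph → Coloured P blue (f i) (f j)

    fromCentre : ∀ j → Reach graph fzero j
    fromCentre fzero    = here
    fromCentre (fsuc j) = step (inj₁ (spokes j)) here

    connected : Connected graph
    connected fzero    j = fromCentre j
    connected (fsuc i) j = step (inj₂ (spokes i)) (fromCentre j)

  open BlueGraph

  blueGraph-ended : ∀ {P c} → BlueGraph P c → m ≤ c → Ended (suc N) m P
  blueGraph-ended G m≤c =
    inj₂ (graph G , (connected G , ≤-trans m≤c (size G)) , f , f-injective , blues G)

  blueGraph-∷ : ∀ {P c e} → BlueGraph P c → BlueGraph (e ∷ P) c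
  blueGraph-∷ G = record
    { graph = graph G ; spokes = spokes G ; size = size G ; blues = coloured-∷ ∘ blues G }

  star : ∀ {P} → (∀ i → Coloured P blue (f fzero) (leaf i)) → BlueGraph P N
  star {P} blue-spoke = record
    { graph = record
        { edges   = map spoke (allFin N)
        ; ordered = All.tabulate spoke-ordered
        ; unique  = map⁺ spoke-injective (allFin⁺ N) }
    ; spokes = λ i → ∈-map⁺ spoke (∈-allFin i)
    ; size   = ≤-reflexive (sym (trans (length-map spoke (allFin N)) (length-tabulate id)))
    ; blues  = spoke-blue }
    where
    spoke : Fin N → Fin (suc N) × Fin (suc N)
    spoke i = fzero , fsuc i
    spoke-injective : Injective _≡_ _≡_ spoke
    spoke-injective refl = refl
    spoke-ordered : ∀ {e} → e ∈ map spoke (allFin N) → toℕ (proj₁ e) < toℕ (proj₂ e)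
    spoke-ordered e∈ with ∈-map⁻ spoke e∈
    ... | _ , _ , refl = s≤s z≤n
    spoke-blue : ∀ {i j} → (i , j) ∈ map spoke (allFin N) → Coloured P blue (f i) (f j)
    spoke-blue e∈ with ∈-map⁻ spoke e∈
    ... | i , _ , refl = blue-spoke i

  addEdge : ∀ {P e c i j} → toℕ i < toℕ j → ¬ Selected P (f i) (f j) → Coloured (e ∷ P) blue (f i) (f j)
          → BlueGraph P c → BlueGraph (e ∷ P) (suc c)
  addEdge {P} {e} {i = i} {j} i<j ¬sel new G = record
    { graph = record
        { edges   = (i , j) ∷ edges (graph G)
        ; ordered = i<j ∷ ordered (graph G)
        -- An edge already in the graph is blue in `P`, hence selected, so an unselected pair cannot
        -- be a repetition.
        ; unique  = All.tabulate (λ { ij∈ refl → ¬sel (blue , blues G ij∈) }) ∷ unique (graph G) }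
    ; spokes = there ∘ spokes G
    ; size   = s≤s (size G)
    ; blues  = blues′ }
    where
    blues′ : ∀ {k l} → (k , l) ∈ (i , j) ∷ edges (graph G) → Coloured (e ∷ P) blue (f k) (f l)
    blues′ (here refl) = new
    blues′ (there kl∈) = coloured-∷ (blues G kl∈)

  -- Among the leaves, new edges lie between indices up to that of `z`; this keeps the later leaves
  -- fresh.
  record Extends (z : Fin N) (P P′ : Position) : Set where
    field
      preserves : ∀ {c a b} → Coloured P c a b → Coloured P′ c a b
      reflects  : ∀ {a b} → Selected P′ (leaf a) (leaf b)
                → Selected P (leaf a) (leaf b) ⊎ (toℕ a ≤ toℕ z × toℕ b ≤ toℕ z)

  open Extends

  extends-refl : ∀ {z P} → Extends z P P
  extends-refl = record { preserves = id ; reflects = inj₁ }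

  extends-∷ : ∀ {z x P P′ c} → toℕ x < toℕ z → Extends z P P′ → Extends z P ((leaf z , leaf x , c) ∷ P′)
  extends-∷ {z} {x} {P} {P′} x<z E = record
    { preserves = coloured-∷ ∘ preserves E ; reflects = reflects′ ∘ selected-∷⁻ }
    where
    reflects′ : ∀ {a b} → (leaf a ≡ leaf z × leaf b ≡ leaf x) ⊎ (leaf a ≡ leaf x × leaf b ≡ leaf z)
                ⊎ Selected P′ (leaf a) (leaf b)
              → Selected P (leaf a) (leaf b) ⊎ (toℕ a ≤ toℕ z × toℕ b ≤ toℕ z)
    reflects′ (inj₁ (a≡z , b≡x)) with leaf-injective a≡z | leaf-injective b≡x
    ... | refl | refl = inj₂ (≤-refl , <⇒≤ x<z)
    reflects′ (inj₂ (inj₁ (a≡x , b≡z))) with leaf-injective a≡x | leaf-injective b≡z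
    ... | refl | refl = inj₂ (<⇒≤ x<z , ≤-refl)
    reflects′ (inj₂ (inj₂ s)) = reflects E s

  Open : Position → Fin N → Fin N → Set
  Open P z x = toℕ x < toℕ z × ¬ Selected P (leaf z) (leaf x)

  open⇒≢ : ∀ {P z x} → Open P z x → leaf z ≢ leaf x
  open⇒≢ (x<z , _) eq = <-irrefl (cong toℕ (sym (leaf-injective eq))) x<z

  open-∷ : ∀ {P z x c ys} → All (x ≢_) ys → All (Open P z) ys → All (Open ((leaf z , leaf x , c) ∷ P) z) ys
  open-∷ [] [] = []
  open-∷ {P} {z} {x} (x≢y ∷ x≢) (_∷_ {y} o@(y<z , ¬sel) os) = (y<z , ¬sel′ ∘ selected-∷⁻) ∷ open-∷ x≢ os
    where
    ¬sel′ : ¬ ((leaf z ≡ leaf z × leaf y ≡ leaf x) ⊎ (leaf z ≡ leaf x × leaf y ≡ leaf z)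
               ⊎ Selected P (leaf z) (leaf y))
    ¬sel′ (inj₁ (_ , y≡x))        = x≢y (sym (leaf-injective y≡x))
    ¬sel′ (inj₂ (inj₁ (_ , y≡z))) = open⇒≢ {P} o (sym y≡z)
    ¬sel′ (inj₂ (inj₂ s))         = ¬sel s

  blueGraph-blue : ∀ {P z x c} → Open P z x → BlueGraph P c
                 → BlueGraph ((leaf z , leaf x , blue) ∷ P) (suc c)
  blueGraph-blue (x<z , ¬sel) =
    -- Builder plays from the later leaf `z`, while edges of the graph run from the smaller index to
    -- the larger; hence both swaps.
    addEdge (s≤s x<z) (λ { (c , s) → ¬sel (c , swap s) }) (swap coloured-new)

  RedPair : Position → Fin N × Fin N → Set
  RedPair P (x , y) = leaf x ≢ leaf y × Coloured P red (leaf x) (leaf y)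

  redPair-∷ : ∀ {P e p} → RedPair P p → RedPair (e ∷ P) p
  redPair-∷ (x≢y , r) = x≢y , coloured-∷ r

  -- Processing one leaf.

  -- The two fates of `z` are continuations, supplied by the recursion over the leaves. In
  -- `rounds d w`, `d` blue edges are missing at two rounds each and `w` red edges may be wasted. In
  -- `pair` one of the two rounds meant for the next blue edge has just gone on a red one, so
  -- `suc d` edges are still missing.
  module Insert
    (z : Fin N) (P₀ : Position) (U₀ : List (Fin N)) (b w : ℕ)
    (single : ∀ {P c} d → Extends z P₀ P → BlueGraph P c → b + length U₀ ≤ c → m ≤ c + d
            → Wins (rounds d w) P)
    (pair : ∀ {P c x U} d → x ∷ U ↭ U₀ → Extends z P₀ P → RedPair P (z , x) → BlueGraph P c
          → b ≤ c → m ≤ c + suc d → Wins (suc (rounds d w)) P)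
    where

    -- `done` collects the singles already joined to `z` in blue. A red reply at `x` must hand back
    -- all singles other than `x`, in any order, which explains the permutation.
    insertSingles : ∀ {P c} d done todo → done ++ todo ↭ U₀ → Extends z P₀ P
                  → Unique todo → All (Open P z) todo → BlueGraph P c
                  → b ≤ c → b + length U₀ ≤ c + length todo → m ≤ c + d → Wins (rounds d w) P
    insertSingles {c = c} d done [] _ E _ _ G _ bound m≤ =
      single d E G (subst (_ ≤_) (+-identityʳ c) bound) m≤
    insertSingles {c = c} zero done (x ∷ todo) _ _ _ _ G _ _ m≤ =
      wins-ended w (blueGraph-ended G (subst (m ≤_) (+-identityʳ c) m≤))
    insertSingles {P} {c} (suc d) done (x ∷ todo) perm E (x≢ ∷ uniq) (o@(x<z , ¬sel) ∷ os) G b≤c bound m≤ =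
      inj₂ (leaf z , leaf x , open⇒≢ {P} o , ¬sel , reply)
      where
      perm′ : x ∷ done ++ todo ↭ U₀
      perm′ = ↭-trans (↭-sym (shift x done todo)) perm
      reply : ∀ col → Wins (suc (rounds d w)) ((leaf z , leaf x , col) ∷ P)
      -- An immediate blue reply uses one of the two reserved rounds; the other is given up.
      reply blue = wins-suc (rounds d w)
        (insertSingles d (x ∷ done) todo perm′ (extends-∷ x<z E) uniq (open-∷ x≢ os) (blueGraph-blue o G)
          (m≤n⇒m≤1+n b≤c) (subst (b + length U₀ ≤_) (+-suc c _) bound) (subst (m ≤_) (+-suc c d) m≤))
      reply red = pair d perm′ (extends-∷ x<z E) (open⇒≢ {P} o , coloured-new) (blueGraph-∷ G) b≤c m≤

    -- Unless the game ends, each pair yields one blue edge within two rounds, so `w` is not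
    -- touched.
    insertPairs : ∀ {P c} d M → Extends z P₀ P → All (RedPair P) M
                → Unique (flatten M ++ U₀) → All (Open P z) (flatten M ++ U₀) → BlueGraph P c
                → b ≤ c + length M → m ≤ c + d → Wins (rounds d w) P
    insertPairs {c = c} d [] E _ uniq os G b≤c m≤ =
      insertSingles d [] U₀ ↭-refl E uniq os G b≤c′ (+-monoˡ-≤ (length U₀) b≤c′) m≤
      where b≤c′ = subst (b ≤_) (+-identityʳ c) b≤c
    insertPairs {c = c} zero (_ ∷ _) _ _ _ _ G _ m≤ =
      wins-ended w (blueGraph-ended G (subst (m ≤_) (+-identityʳ c) m≤))
    insertPairs {P} {c} (suc d) ((x , y) ∷ M) E ((x≢y′ , xy) ∷ reds) ((x≢y ∷ x≢) ∷ y≢ ∷ uniq)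
                (ox@(x<z , ¬zx) ∷ oy ∷ os) G b≤c m≤ =
      inj₂ (leaf z , leaf x , open⇒≢ {P} ox , ¬zx , reply)
      where
      b≤c′ = subst (b ≤_) (+-suc c _) b≤c
      m≤′ = subst (m ≤_) (+-suc c d) m≤
      reply : ∀ col → Wins (suc (rounds d w)) ((leaf z , leaf x , col) ∷ P)
      reply blue = wins-suc (rounds d w)
        (insertPairs d M (extends-∷ x<z E) (All.map redPair-∷ reds) uniq (open-∷ x≢ os)
          (blueGraph-blue ox G) b≤c′ m≤′)
      reply red with open-∷ {c = red} (x≢y ∷ x≢) (oy ∷ os)
      ... | oy′@(y<z , ¬zy) ∷ os′ = inj₂ (leaf z , leaf y , open⇒≢ {P} oy , ¬zy , reply′)
        where
        reply′ : ∀ col → Wins (rounds d w) ((leaf z , leaf y , col) ∷ (leaf z , leaf x , red) ∷ P)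
        reply′ blue =
          insertPairs d M (extends-∷ y<z (extends-∷ x<z E)) (All.map (redPair-∷ ∘ redPair-∷) reds) uniq
            (open-∷ y≢ os′) (blueGraph-blue oy′ (blueGraph-∷ G)) b≤c′ m≤′
        reply′ red = wins-ended (rounds d w)
          (inj₁ (triangle (open⇒≢ {P} ox) x≢y′ (open⇒≢ {P} oy)
                  (coloured-∷ coloured-new) (coloured-∷ (coloured-∷ xy)) coloured-new))

  -- Processing all leaves.

  -- These properties make `xs` an enumeration of the leaves of index below `j`. It is applied to
  -- `flatten M ++ U`, where `count` becomes `2k + u = j`.
  record Processed (j : ℕ) (xs : List (Fin N)) : Set where
    field
      distinct : Unique xs
      below    : All (λ x → toℕ x < j) xs
      count    : length xs ≡ j

  open Processed

  processed-↭ : ∀ {j xs ys} → xs ↭ ys → Processed j xs → Processed j ys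
  processed-↭ p R = record
    { distinct = Permutationₛ.Unique-resp-↭ (setoid (Fin N)) (↭⇒↭ₛ p) (distinct R)
    ; below    = All-resp-↭ p (below R)
    ; count    = trans (sym (↭-length p)) (count R) }

  processed-∷ : ∀ {z xs} → Processed (toℕ z) xs → Processed (suc (toℕ z)) (z ∷ xs)
  processed-∷ R = record
    { distinct = All.map (λ { x<z refl → <-irrefl refl x<z }) (below R) ∷ distinct R
    ; below    = ≤-refl ∷ All.map m≤n⇒m≤1+n (below R)
    ; count    = cong suc (count R) }

  module _ (m-bound : 4 * m ≤ N ^ 2) where

    -- Induction on the `t` leaves still to be processed. Each may cost one red edge with no forced
    -- blue edge after it: either `w` covers all of these, or a hub makes such an edge end the game.
    addEdges : ∀ t {j P c} d w M U → j + t ≡ N → Processed j (flatten M ++ U)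
             → (∀ a b → j ≤ toℕ a → a ≢ b → ¬ Selected P (leaf a) (leaf b))
             → All (RedPair P) M → BlueGraph P c
             → (let u = length U ; k = length M in
                2 * N + (u * u + 2 * (k * u) + 2 * (k * k)) ≤ 2 * c + j)
             → m ≤ c + d → t ≤ w ⊎ RedHub P → Wins (rounds d w) P
    addEdges zero {j} {P} {c} d w M U j≡N R _ _ G bound _ _ =
      wins-ended (rounds d w) (blueGraph-ended G m≤c)
      where
      u = length U
      k = length M
      j≡ : 2 * k + u ≡ j
      j≡ = trans (cong (_+ u) (sym (length-flatten M))) (trans (sym (length-++ (flatten M))) (count R))
      N≡ : N ≡ 2 * k + u
      N≡ = trans (sym j≡N) (trans (+-identityʳ j) (sym j≡))
      m≤c : m ≤ c
      m≤c = final-bound u k (subst (λ x → 4 * m ≤ x ^ 2) N≡ m-bound)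
        (subst (λ x → 2 * x + (u * u + 2 * (k * u) + 2 * (k * k)) ≤ 2 * c + (2 * k + u)) N≡
          (subst (λ x → 2 * N + (u * u + 2 * (k * u) + 2 * (k * k)) ≤ 2 * c + x) (sym j≡) bound))
    addEdges (suc t) {j} {P} {c} d w M U j+t≡N R fresh reds G bound m≤ waste = go z toℕz≡j
      where
      j<N : j < N
      j<N = subst (j <_) j+t≡N (m<m+n j (s≤s z≤n))
      z = fromℕ< j<N
      toℕz≡j : toℕ z ≡ j
      toℕz≡j = toℕ-fromℕ< j<N

      -- With `z` a variable, matching on the equation replaces `j` by `toℕ z` throughout.
      go : (z : Fin N) → toℕ z ≡ j → Wins (rounds d w) P
      go z refl = insertPairs d M extends-refl reds (distinct R)
          (All.map (λ x<z → x<z , fresh z _ ≤-refl (λ { refl → <-irrefl refl x<z })) (below R))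
          G ≤-refl m≤
        where
        fresh′ : ∀ {P′} → Extends z P P′ → ∀ a b → suc (toℕ z) ≤ toℕ a → a ≢ b → ¬ Selected P′ (leaf a) (leaf b)
        fresh′ E a b z<a a≢b s with reflects E s
        ... | inj₁ s′        = fresh a b (<⇒≤ z<a) a≢b s′
        ... | inj₂ (a≤z , _) = <⇒≱ z<a a≤z

        keepReds : ∀ {P′} → Extends z P P′ → All (RedPair P′) M
        keepReds E = All.map (λ { (x≢y , r) → x≢y , preserves E r }) reds

        keepHub : ∀ {P′} → Extends z P P′ → RedHub P → RedHub P′
        keepHub E (h , h≢ , hub) = h , h≢ , preserves E ∘ hub

        j+t≡N′ : suc (toℕ z) + t ≡ N
        j+t≡N′ = trans (sym (+-suc (toℕ z) t)) j+t≡N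

        single : ∀ {P′ c′} d → Extends z P P′ → BlueGraph P′ c′ → c + length M + length U ≤ c′ → m ≤ c′ + d
               → Wins (rounds d w) P′
        single d E G′ c≤c′ m≤′ =
          addEdges t d w M (z ∷ U) j+t≡N′
            (processed-↭ (↭-sym (shift z (flatten M) U)) (processed-∷ R))
            (fresh′ E) (keepReds E) G′ (singles-bound N (length U) (length M) bound c≤c′) m≤′
            (map-⊎ (≤-trans (n≤1+n t)) (keepHub E) waste)

        pair : ∀ {P′ c′ x U′} d → x ∷ U′ ↭ U → Extends z P P′ → RedPair P′ (z , x) → BlueGraph P′ c′
             → c + length M ≤ c′ → m ≤ c′ + suc d → Wins (suc (rounds d w)) P′
        pair {P′} {x = x} {U′} d p E zx@(z≢x , r) G′ c≤c′ m≤′ = result w waste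
          where
          bound′ = pairs-bound N (length U′) (length M)
            (subst (λ u → 2 * N + (u * u + 2 * (length M * u) + 2 * (length M * length M)) ≤ 2 * c + toℕ z)
              (sym (↭-length p)) bound) c≤c′
          p′ : flatten M ++ U ↭ x ∷ flatten M ++ U′
          p′ = ↭-trans (++⁺ˡ (flatten M) (↭-sym p)) (shift x (flatten M) U′)
          result : ∀ w → suc t ≤ w ⊎ RedHub P → Wins (suc (rounds d w)) P′
          result w (inj₂ hub) = inj₁ (hub-ended (keepHub E hub) (z≢x ∘ cong f) r)
          -- The red edge is charged to the waste allowance: `suc (rounds d (suc w))` equals
          -- `rounds (suc d) w`.
          result (suc w) (inj₁ (s≤s t≤w)) = subst (λ k → Wins (suc k) P′) (sym (rounds-suc d w))
            (addEdges t (suc d) w ((z , x) ∷ M) U′ j+t≡N′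
              (processed-↭ (↭-prep z p′) (processed-∷ R))
              (fresh′ E) (zx ∷ keepReds E) G′ bound′ m≤′ (inj₁ t≤w))

        open Insert z P U (c + length M) w single pair

    star-wins : ∀ {P e} w → (∀ i → Coloured P blue (f fzero) (leaf i))
              → (∀ a b → a ≢ b → ¬ Selected P (leaf a) (leaf b))
              → m ≡ N + e → N ≤ w ⊎ RedHub P → Wins (rounds e w) P
    star-wins {e = e} w spoke fresh m≡ waste =
      -- Nothing is processed yet: the `N` spokes are the only blue edges counted, and `e` are
      -- missing.
      addEdges N e w [] [] refl (record { distinct = [] ; below = [] ; count = refl })
        (λ a b _ → fresh a b) [] (star spoke) ≤-refl (≤-reflexive m≡) waste

    -- The hub forces each of the `t` missing spokes to be blue at one round apiece; afterwards it
    -- rules out waste, so the allowance is 0.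
    hub-wins : ∀ t {j P e} → j + t ≡ N → RedHub P
             → (∀ i → toℕ i < j → Coloured P blue (f fzero) (leaf i))
             → (∀ i → j ≤ toℕ i → ¬ Selected P (f fzero) (leaf i))
             → (∀ a b → a ≢ b → ¬ Selected P (leaf a) (leaf b))
             → m ≡ N + e → Wins (t + rounds e 0) P
    hub-wins zero {j} {e = e} j≡N hub spoke _ fresh m≡ =
      star-wins 0 (λ i → spoke i (subst (toℕ i <_) (sym (trans (sym (+-identityʳ j)) j≡N)) (toℕ<n i))) fresh m≡ (inj₂ hub)
    hub-wins (suc t) {j} {P} {e} j+t≡N hub spoke unspoke fresh m≡ = go (fromℕ< j<N) (toℕ-fromℕ< j<N)
      where
      j<N : j < N
      j<N = subst (j <_) j+t≡N (m<m+n j (s≤s z≤n))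
      f0≢ : ∀ {i} → f fzero ≢ leaf i
      f0≢ eq with f-injective eq
      ... | ()
      go : (z : Fin N) → toℕ z ≡ j → Wins (suc t + rounds e 0) P
      go z refl = inj₂ (f fzero , leaf z , f0≢ , unspoke z ≤-refl , reply)
        where
        spoke′ : ∀ i → toℕ i < suc (toℕ z) → Coloured ((f fzero , leaf z , blue) ∷ P) blue (f fzero) (leaf i)
        spoke′ i (s≤s i≤z) with m≤n⇒m<n∨m≡n i≤z
        ... | inj₁ i<z = coloured-∷ (spoke i i<z)
        ... | inj₂ i≡z rewrite toℕ-injective i≡z = coloured-new
        unspoke′ : ∀ i → suc (toℕ z) ≤ toℕ i → ¬ Selected ((f fzero , leaf z , blue) ∷ P) (f fzero) (leaf i)
        unspoke′ i z<i s with selected-∷⁻ s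
        ... | inj₁ (_ , i≡z)        = <-irrefl (cong toℕ (sym (leaf-injective i≡z))) z<i
        ... | inj₂ (inj₁ (f0≡ , _)) = f0≢ f0≡
        ... | inj₂ (inj₂ s′)        = unspoke i (<⇒≤ z<i) s′
        fresh′ : ∀ a b → a ≢ b → ¬ Selected ((f fzero , leaf z , blue) ∷ P) (leaf a) (leaf b)
        fresh′ a b a≢b s with selected-∷⁻ s
        ... | inj₁ (a≡0 , _)        = f0≢ (sym a≡0)
        ... | inj₂ (inj₁ (_ , b≡0)) = f0≢ (sym b≡0)
        ... | inj₂ (inj₂ s′)        = fresh a b a≢b s′
        reply : ∀ col → Wins (t + rounds e 0) ((f fzero , leaf z , col) ∷ P)
        reply red  = wins-ended (t + rounds e 0) (hub-ended (hub-∷ hub) (λ ()) coloured-new)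
        reply blue = hub-wins t (trans (sym (+-suc (toℕ z) t)) j+t≡N) (hub-∷ hub) spoke′ unspoke′ fresh′ m≡

-- The opening star at vertex 0.

-- After `k` rounds the vertices up to `k` have been used, and `bounded` makes `suc k` new. The
-- leaves form an injective labelling, ready to serve as a copy of a graph.
record Leaves (P : Position) (col : Colour) (k b : ℕ) : Set where
  field
    vertex    : Fin b → ℕ
    injective : Injective _≡_ _≡_ vertex
    positive  : ∀ i → 0 ≢ vertex i
    bounded   : ∀ i → vertex i ≤ k
    coloured  : ∀ i → Coloured P col 0 (vertex i)

open Leaves

noLeaves : ∀ {P col k} → Leaves P col k 0
noLeaves = record
  { vertex = λ () ; injective = λ { {()} } ; positive = λ () ; bounded = λ () ; coloured = λ () }

leaves-∷ : ∀ {P e col k b} → Leaves P col k b → Leaves (e ∷ P) col (suc k) b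
leaves-∷ L = record
  { vertex = vertex L ; injective = injective L ; positive = positive L
  ; bounded = m≤n⇒m≤1+n ∘ bounded L ; coloured = coloured-∷ ∘ coloured L }

newLeaf : ∀ {P col k b} → Leaves P col k b → Leaves ((0 , suc k , col) ∷ P) col (suc k) (suc b)
newLeaf {P} {col} {k} {b} L = record
  { vertex = v ; injective = v-injective ; positive = v-positive ; bounded = v-bounded ; coloured = v-coloured }
  where
  v : Fin (suc b) → ℕ
  v fzero    = suc k
  v (fsuc i) = vertex L i
  old≢ : ∀ i → vertex L i ≢ suc k
  old≢ i eq = <⇒≢ (s≤s (bounded L i)) eq
  v-injective : Injective _≡_ _≡_ v
  v-injective {fzero}  {fzero}  _  = refl
  v-injective {fzero}  {fsuc j} eq = contradiction (sym eq) (old≢ j)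
  v-injective {fsuc i} {fzero}  eq = contradiction eq (old≢ i)
  v-injective {fsuc i} {fsuc j} eq = cong fsuc (injective L eq)
  v-positive : ∀ i → 0 ≢ v i
  v-positive fzero    ()
  v-positive (fsuc i) = positive L i
  v-bounded : ∀ i → v i ≤ suc k
  v-bounded fzero    = ≤-refl
  v-bounded (fsuc i) = m≤n⇒m≤1+n (bounded L i)
  v-coloured : ∀ i → Coloured ((0 , suc k , col) ∷ P) col 0 (v i)
  v-coloured fzero    = coloured-new
  v-coloured (fsuc i) = coloured-∷ (coloured L i)

withCentre : ∀ {b} → (Fin b → ℕ) → Fin (suc b) → ℕ
withCentre v fzero    = 0
withCentre v (fsuc i) = v i

withCentre-injective : ∀ {P col k b} (L : Leaves P col k b) → Injective _≡_ _≡_ (withCentre (vertex L))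
withCentre-injective L {fzero}  {fzero}  _  = refl
withCentre-injective L {fzero}  {fsuc j} eq = contradiction eq (positive L j)
withCentre-injective L {fsuc i} {fzero}  eq = contradiction (sym eq) (positive L i)
withCentre-injective L {fsuc i} {fsuc j} eq = cong fsuc (injective L eq)

StarAt0 : Position → ℕ → Set
StarAt0 P k = ∀ {a b} → Selected P a b → (0 ≡ a × b ≤ k) ⊎ (0 ≡ b × a ≤ k)

starAt0-∷ : ∀ {P k c} → StarAt0 P k → StarAt0 ((0 , suc k , c) ∷ P) (suc k)
starAt0-∷ S s with selected-∷⁻ s
... | inj₁ (refl , refl)        = inj₁ (refl , ≤-refl)
... | inj₂ (inj₁ (refl , refl)) = inj₂ (refl , ≤-refl)
... | inj₂ (inj₂ s′) with S s′
...   | inj₁ (eq , b≤k) = inj₁ (eq , m≤n⇒m≤1+n b≤k)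
...   | inj₂ (eq , a≤k) = inj₂ (eq , m≤n⇒m≤1+n a≤k)

starAt0-free : ∀ {P k a b} → StarAt0 P k → 0 ≢ a → 0 ≢ b → ¬ Selected P a b
starAt0-free S 0≢a 0≢b s with S s
... | inj₁ (eq , _) = 0≢a eq
... | inj₂ (eq , _) = 0≢b eq

-- Combining the opening with the two endgames.

module _ {N m e : ℕ} (m-bound : 4 * m ≤ N ^ 2) (m≡ : m ≡ N + e) where

  blueLeaves-win : ∀ {P k} → StarAt0 P k → Leaves P blue k N → BuilderWinsWithin (suc N) m (rounds e N) P
  blueLeaves-win S L =
    BlueStar.star-wins (withCentre (vertex L)) (withCentre-injective L) m-bound N (coloured L)
      (λ a b _ → starAt0-free S (positive L a) (positive L b)) m≡ (inj₁ ≤-refl)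

  redLeaves-win : ∀ {P k} → StarAt0 P k → Leaves P red k (suc N) → BuilderWinsWithin (suc N) m (N + rounds e 0) P
  redLeaves-win S L =
    BlueStar.hub-wins (vertex L) (injective L) m-bound N refl (0 , positive L , coloured L) (λ _ ())
      (λ i _ → starAt0-free S (positive L fzero) (positive L (fsuc i)))
      (λ a b _ → starAt0-free S (positive L (fsuc a)) (positive L (fsuc b))) m≡

  -- Every round lowers `s` or `t`, the blue and red neighbours still wanted. Both endgames fit in
  -- `N + 2 * e` rounds: the `N` pays for wasted red edges in one and for forced spokes in the
  -- other. The red target is `suc N` because 0 is then the hub, outside the blue copy.
  growStar : ∀ s t {P k b r} → StarAt0 P k → b + s ≡ N → r + t ≡ suc N
           → Leaves P blue k b → Leaves P red k r → BuilderWinsWithin (suc N) m (s + t + (N + 2 * e)) P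
  growStar zero t {P} {k} {b} S b≡ _ B _ =
    wins-+ t (subst (λ x → BuilderWinsWithin (suc N) m x P) (rounds-+ e N)
      (blueLeaves-win S (subst (Leaves P blue k) (trans (sym (+-identityʳ b)) b≡) B)))
  growStar (suc s) zero {P} {k} {r = r} S _ r≡ _ R =
    wins-+ (suc s + 0) (subst (λ x → BuilderWinsWithin (suc N) m (N + x) P) (rounds-+ e 0)
      (redLeaves-win S (subst (Leaves P red k) (trans (sym (+-identityʳ r)) r≡) R)))
  growStar (suc s) (suc t) {P} {k} {b} {r} S b≡ r≡ B R = inj₂ (0 , suc k , (λ ()) , free , reply)
    where
    free : ¬ Selected P 0 (suc k)
    free sel with S sel
    ... | inj₁ (_ , k<k) = <-irrefl refl k<k
    reply : ∀ col → BuilderWinsWithin (suc N) m (s + suc t + (N + 2 * e)) ((0 , suc k , col) ∷ P)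
    reply blue = growStar s (suc t) (starAt0-∷ S) (trans (sym (+-suc b s)) b≡) r≡ (newLeaf B) (leaves-∷ R)
    reply red  = subst (λ x → BuilderWinsWithin (suc N) m (x + (N + 2 * e)) ((0 , suc k , red) ∷ P)) (sym (+-suc s t))
      (growStar (suc s) t (starAt0-∷ S) b≡ (trans (sym (+-suc r t)) r≡) (leaves-∷ B) (newLeaf R))

  builder-wins : OnlineRamseyLe (suc N) m (suc N + 2 * m)
  builder-wins = subst (λ x → BuilderWinsWithin (suc N) m x []) (trans (lemma N e) (cong (λ x → suc N + 2 * x) (sym m≡)))
    (growStar N (suc N) {k = 0} (λ { (_ , inj₁ ()) ; (_ , inj₂ ()) }) refl refl noLeaves noLeaves)
    where
    lemma : ∀ N e → N + suc N + (N + 2 * e) ≡ suc N + 2 * (N + e)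
    lemma = solve-∀

theorem3 : ∃[ C ] ((n m : ℕ) → 3 ≤ n → n ∸ 1 ≤ m → 4 * m ≤ (n ∸ 1) ^ 2
    → ∃[ k ] (OnlineRamseyLe n m k
    × (k ∸ (n + 2 * m)) ^ 2 ≤ C ^ 2 * (m + 1 ∸ n)))
-- The strategy takes at most `n + 2 * m` rounds, so the excess to be bounded is 0 and the constant
-- 0 works.
theorem3 = 0 , λ { (suc N) m _ N≤m m-bound →
  suc N + 2 * m , builder-wins m-bound (sym (m+[n∸m]≡n N≤m)) ,
  ≤-reflexive (cong (_^ 2) (n∸n≡0 (suc N + 2 * m))) }
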